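{- Let $M$ be a matroid of rank $r$, with rank function also denoted $r(\cdot)$ and closure operator $\mathrm{cl}$. Then $M$ is a fundamental transversal matroid if and only if there is an injection $\phi:\mathcal{Z}(M)\to 2^{[r]}$ with (1) $|\phi(F)|=r(F)$ for all $F\in\mathcal{Z}(M)$, (2) $\phi\bigl(\mathrm{cl}(F\cup G)\bigr)=\phi(F)\cup\phi(G)$ for all $F,G\in\mathcal{Z}(M)$, and (3) $r\bigl(\bigcap_{F\in\mathcal{F}}F\bigr)=\bigl|\bigcap_{F\in\mathcal{F}}\phi(F)\bigr|$ for every subset $\mathcal{F}$ of $\mathcal{Z}(M)$. Moreover, in (3), "every subset" may equivalently be replaced by "every filter", or by "every antichain".
   Context: Matroids have finite ground sets; $E(M)$ is the ground set of $M$. A set $X\subseteq E(M)$ is cyclic if it is a union of circuits of $M$ (the empty set is cyclic). $\mathcal{Z}(M)$ is the set of all cyclic flats of $M$, ordered by inclusion; it is a lattice in which the join of $F,G$ is $\mathrm{cl}(F\cup G)$. An antichain in $\mathcal{Z}(M)$ is a subset $\mathcal{F}\subseteq\mathcal{Z}(M)$ no two of whose members are related by inclusion. A filter in $\mathcal{Z}(M)$ is a subset $\mathcal{F}\subseteq\mathcal{Z}(M)$ such that if $A\in\mathcal{F}$, $B\in\mathcal{Z}(M)$ and $A\subseteq B$, then $B\in\mathcal{F}$. $[r]=\{1,\ldots,r\}$ and $2^{[r]}$ is the set of all subsets of $[r]$. For the empty family $\mathcal{F}$, the intersection of members of $\mathcal{F}$ is $E(M)$ and the intersection of the sets $\phi(F)$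 is $[r]$. A set system on a set $S$ is a finite multiset $(A_1,\ldots,A_s)$ of subsets of $S$. A partial transversal of it is a subset $I\subseteq S$ for which there is an injection $\psi:I\to\{1,\ldots,s\}$ with $x\in A_{\psi(x)}$ for all $x\in I$. The partial transversals are the independent sets of a matroid on $S$; such a matroid is called transversal and the set system is a presentation of it. A fundamental transversal matroid is a transversal matroid that has a presentation $(A_1,\ldots,A_s)$ for which no difference $A_i-\bigcup_{j\ne i}A_j$, for $1\le i\le s$, is empty. (Equivalently, $M$ is a matroid having a fundamental basis, that is, a basis $B$ such that each $F\in\mathcal{Z}(M)$ is spanned by $B\cap F$.) -}

module Defs where

open import Data.Empty using (⊥-elim)
open import Data.Fin using (Fin; _≟_)
open import Data.Fin.Properties using (any?)
open import Data.Fin.Subset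
open import Data.Fin.Subset.Properties
open import Data.Irrelevant using ([_])
open import Data.List using (List; []; _∷_; _++_; map; filter; allFin; concatMap)
open import Data.List.Extrema.Nat using (max; argmax-all; v≤max⁺)
open import Data.List.Membership.Propositional
  using () renaming (_∈_ to _∈ˡ_)
open import Data.List.Membership.Propositional.Properties
  using (∈-map⁺; ∈-map⁻; ∈-++⁺ˡ; ∈-++⁺ʳ; ∈-filter⁺; ∈-filter⁻;
         ∈-concatMap⁺; ∈-concatMap⁻; ∈-allFin)
open import Data.List.Relation.Unary.All as All using (All)
open import Data.List.Relation.Unary.Any as Any using (here; there)
open import Data.Nat using (ℕ; zero; suc; _≤_; _<_)
import Data.Nat.Properties as ℕ
open import Data.Nat.Induction using (<-wellFounded)
open import Data.Product using (∃; ∃₂; _×_; _,_; proj₁; proj₂)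
open import Data.Refinement using (Refinement; value; _,_)
open import Data.Sum using (inj₁; inj₂)
open import Data.Vec using (tabulate; []; _∷_)
open import Data.Vec.Properties using (lookup∘tabulate; []=⇒lookup; lookup⇒[]=)
open import Function using (_∘_; _$_; id)
open import Function.Bundles using (_⇔_; _↣_; module Injection)
open import Induction.WellFounded using (Acc; acc)
open import Level using (0ℓ)
open import Relation.Binary.PropositionalEquality
  using (_≡_; refl; sym; trans; subst)
open import Relation.Nullary using (¬_; Dec; yes; no; does; ¬?; _×-dec_)
open import Relation.Nullary.Decidable using (dec-true)
open import Relation.Unary using (Pred; Decidable)

-- Matroids on a ground set with n elements, identified with Fin n.  Asking for
-- independence to be decidable is no restriction classically; it makes the
-- rank of a set computable.
record Matroid (n : ℕ) : Set₁ where
  field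
    Indep      : Pred (Subset n) 0ℓ
    indep?     : Decidable Indep
    empty      : Indep ⊥
    hereditary : ∀ {I J} → J ⊆ I → Indep I → Indep J
    augment    : ∀ {I J} → Indep I → Indep J → ∣ I ∣ < ∣ J ∣ →
                 ∃ λ x → x ∈ J × x ∉ I × Indep (I ∪ ⁅ x ⁆)

subsets : ∀ n → List (Subset n)
subsets zero    = [] ∷ []
subsets (suc n) = map (inside ∷_) (subsets n) ++ map (outside ∷_) (subsets n)

module _ {n : ℕ} (M : Matroid n) where
  open Matroid M

  rank : Subset n → ℕ
  rank X = max 0 (map ∣_∣ (filter (λ I → (I ⊆? X) ×-dec indep? I) (subsets n)))

  cl : Subset n → Subset n
  cl X = tabulate λ x → does (rank (X ∪ ⁅ x ⁆) ℕ.≟ rank X)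

  Circuit : Pred (Subset n) 0ℓ
  Circuit C = ¬ Indep C × (∀ {D} → D ⊂ C → Indep D)

  Flat : Pred (Subset n) 0ℓ
  Flat X = cl X ≡ X

  Cyclic : Pred (Subset n) 0ℓ
  Cyclic X = ∃ λ (Cs : List (Subset n)) → All Circuit Cs × ⋃ Cs ≡ X

  CyclicFlat : Pred (Subset n) 0ℓ
  CyclicFlat X = Cyclic X × Flat X

  -- The witness is irrelevant, so members of 𝒵 are equal (_≡_) exactly when the
  -- underlying sets are.
  𝒵 : Set
  𝒵 = Refinement (Subset n) CyclicFlat

∈-subsets : ∀ {n} (X : Subset n) → X ∈ˡ subsets n
∈-subsets []            = here refl
∈-subsets (inside  ∷ X) = ∈-++⁺ˡ (∈-map⁺ _ (∈-subsets X))
∈-subsets (outside ∷ X) = ∈-++⁺ʳ _ (∈-map⁺ _ (∈-subsets X))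

∈-⋃⁻ : ∀ {n} {x : Fin n} Cs → x ∈ ⋃ Cs → ∃ λ C → C ∈ˡ Cs × x ∈ C
∈-⋃⁻ []       x∈ = ⊥-elim (∉⊥ x∈)
∈-⋃⁻ (C ∷ Cs) x∈ with x∈p∪q⁻ C (⋃ Cs) x∈
... | inj₁ x∈C = C , here refl , x∈C
... | inj₂ x∈⋃ = let D , D∈Cs , x∈D = ∈-⋃⁻ Cs x∈⋃ in D , there D∈Cs , x∈D

∈-⋃⁺ : ∀ {n} {x : Fin n} {C Cs} → C ∈ˡ Cs → x ∈ C → x ∈ ⋃ Cs
∈-⋃⁺ (here refl) x∈C = x∈p∪q⁺ (inj₁ x∈C)
∈-⋃⁺ (there C∈)  x∈C = x∈p∪q⁺ (inj₂ (∈-⋃⁺ C∈ x∈C))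

∪-lub : ∀ {n} {p q r : Subset n} → p ⊆ r → q ⊆ r → p ∪ q ⊆ r
∪-lub {p = p} {q} p⊆r q⊆r x∈ with x∈p∪q⁻ p q x∈
... | inj₁ x∈p = p⊆r x∈p
... | inj₂ x∈q = q⊆r x∈q

dec-true⁻ : ∀ {P : Set} (P? : Dec P) → does P? ≡ inside → P
dec-true⁻ (yes p) _ = p

⁅⁆⊆ : ∀ {n} {x : Fin n} {p} → x ∈ p → ⁅ x ⁆ ⊆ p
⁅⁆⊆ {x = x} {p} x∈p y∈ = subst (_∈ p) (sym (x∈⁅y⁆⇒x≡y x y∈)) x∈p

module _ {n : ℕ} (M : Matroid n) where
  open Matroid M

  rank-attained : ∀ X → ∃ λ I → I ⊆ X × Indep I × ∣ I ∣ ≡ rank M X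
  rank-attained X = argmax-all id {P = P} (⊥ , ⊥⊆ , empty , ∣⊥∣≡0 n) (All.tabulate go)
    where
    P : ℕ → Set
    P k = ∃ λ I → I ⊆ X × Indep I × ∣ I ∣ ≡ k
    I? = λ I → (I ⊆? X) ×-dec indep? I
    go : ∀ {k} → k ∈ˡ map ∣_∣ (filter I? (subsets n)) → P k
    go k∈ with I , I∈ , refl ← ∈-map⁻ ∣_∣ k∈ =
      let _ , I⊆X , ind = ∈-filter⁻ I? {xs = subsets n} I∈ in I , I⊆X , ind , refl

  indep⇒∣∣≤rank : ∀ {I X} → I ⊆ X → Indep I → ∣ I ∣ ≤ rank M X
  indep⇒∣∣≤rank {I} {X} I⊆X ind = v≤max⁺ 0 _ $ inj₂ $
    Any.map ℕ.≤-reflexive (∈-map⁺ ∣_∣ (∈-filter⁺ I? (∈-subsets I) (I⊆X , ind)))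
    where I? = λ I → (I ⊆? X) ×-dec indep? I

  rank-mono : ∀ {X Y} → X ⊆ Y → rank M X ≤ rank M Y
  rank-mono {X} X⊆Y with I , I⊆X , ind , eq ← rank-attained X =
    ℕ.≤-trans (ℕ.≤-reflexive (sym eq)) (indep⇒∣∣≤rank (⊆-trans I⊆X X⊆Y) ind)

  ∈-cl⁺ : ∀ {x} X → rank M (X ∪ ⁅ x ⁆) ≡ rank M X → x ∈ cl M X
  ∈-cl⁺ {x} X eq = lookup⇒[]= x _
    (trans (lookup∘tabulate _ x) (dec-true (_ ℕ.≟ _) eq))

  ∈-cl⁻ : ∀ {x} X → x ∈ cl M X → rank M (X ∪ ⁅ x ⁆) ≡ rank M X
  ∈-cl⁻ {x} X x∈ = dec-true⁻ (_ ℕ.≟ _) (trans (sym (lookup∘tabulate _ x)) ([]=⇒lookup x∈))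

  X⊆clX : ∀ X → X ⊆ cl M X
  X⊆clX X x∈X = ∈-cl⁺ X $ ℕ.≤-antisym
    (rank-mono (∪-lub ⊆-refl (⁅⁆⊆ x∈X))) (rank-mono (p⊆p∪q _))

  ∣I∪x∣ : ∀ {I : Subset n} {x} → x ∉ I → ∣ I ∣ < ∣ I ∪ ⁅ x ⁆ ∣
  ∣I∪x∣ {I} {x} x∉I = p⊂q⇒∣p∣<∣q∣
    (p⊆p∪q _ , x , x∈p∪q⁺ {p = I} (inj₂ (x∈⁅x⁆ x)) , x∉I)

  -- A largest independent subset of X cannot be extended by an element of cl X.
  basis-maximal : ∀ {X B x} → B ⊆ X → ∣ B ∣ ≡ rank M X →
                  x ∈ cl M X → x ∉ B → ¬ Indep (B ∪ ⁅ x ⁆)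
  basis-maximal {X} {B} {x} B⊆X eq x∈cl x∉B ind = ℕ.<-irrefl refl $ begin-strict
    rank M X             ≡⟨ sym eq ⟩
    ∣ B ∣                <⟨ ∣I∪x∣ x∉B ⟩
    ∣ B ∪ ⁅ x ⁆ ∣        ≤⟨ indep⇒∣∣≤rank (∪-lub (p⊆p∪q _ ∘ B⊆X) (q⊆p∪q X _)) ind ⟩
    rank M (X ∪ ⁅ x ⁆)   ≡⟨ ∈-cl⁻ X x∈cl ⟩
    rank M X             ∎
    where open ℕ.≤-Reasoning

  rank-cl : ∀ X → rank M (cl M X) ≤ rank M X
  rank-cl X
    with B , B⊆X , indB , eqB ← rank-attained X
       | J , J⊆cl , indJ , eqJ ← rank-attained (cl M X) = ℕ.≮⇒≥ λ lt →
    let x , x∈J , x∉B , ind = augment indB indJ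
          (ℕ.≤-<-trans (ℕ.≤-reflexive eqB) (ℕ.<-≤-trans lt (ℕ.≤-reflexive (sym eqJ))))
    in basis-maximal B⊆X eqB (J⊆cl x∈J) x∉B ind

  cl-flat : ∀ X → Flat M (cl M X)
  cl-flat X = ⊆-antisym (λ {x} x∈ → ∈-cl⁺ X (ℕ.≤-antisym (le x∈) (rank-mono (p⊆p∪q _))))
                        (X⊆clX _)
    where
    open ℕ.≤-Reasoning
    le : ∀ {x} → x ∈ cl M (cl M X) → rank M (X ∪ ⁅ x ⁆) ≤ rank M X
    le {x} x∈ = begin
      rank M (X ∪ ⁅ x ⁆)       ≤⟨ rank-mono (∪-lub (p⊆p∪q _ ∘ X⊆clX X) (q⊆p∪q (cl M X) _)) ⟩
      rank M (cl M X ∪ ⁅ x ⁆)  ≡⟨ ∈-cl⁻ (cl M X) x∈ ⟩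
      rank M (cl M X)          ≤⟨ rank-cl X ⟩
      rank M X                 ∎

  dependent⇒circuit : ∀ D → ¬ Indep D → ∃ λ C → C ⊆ D × Circuit M C
  dependent⇒circuit D = go D (<-wellFounded _)
    where
    go : ∀ D → Acc _<_ ∣ D ∣ → ¬ Indep D → ∃ λ C → C ⊆ D × Circuit M C
    go D (acc rs) dep with any? (λ x → (x ∈? D) ×-dec ¬? (indep? (D - x)))
    ... | yes (x , x∈D , dep′) =
      let C , C⊆ , circ = go (D - x) (rs (x∈p⇒∣p-x∣<∣p∣ x∈D)) dep′
      in C , ⊆-trans C⊆ (p─q⊆p D _) , circ
    ... | no none = D , ⊆-refl , dep , minimal
      where
      minimal : ∀ {E} → E ⊂ D → Indep E
      minimal {E} (E⊆D , x , x∈D , x∉E) with indep? (D - x)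
      ... | yes ind = hereditary
        (λ {y} y∈E → x∈p∧x≢y⇒x∈p-y (E⊆D y∈E) λ { refl → x∉E y∈E }) ind
      ... | no dep′ = ⊥-elim (none (x , x∈D , dep′))

  cyclic⁻ : ∀ {X} → Cyclic M X → ∀ {x} → x ∈ X → ∃ λ C → Circuit M C × x ∈ C × C ⊆ X
  cyclic⁻ (Cs , circ , refl) x∈X with C , C∈Cs , x∈C ← ∈-⋃⁻ Cs x∈X =
    C , All.lookup circ C∈Cs , x∈C , ∈-⋃⁺ C∈Cs

  cyclic⁺ : ∀ {X} → (∀ {x} → x ∈ X → ∃ λ C → Circuit M C × x ∈ C × C ⊆ X) → Cyclic M X
  cyclic⁺ {X} h = concatMap pick (allFin n) , All.tabulate (proj₁ ∘ sound) ,
                  ⊆-antisym sub sup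
    where
    pick : Fin n → List (Subset n)
    pick x with x ∈? X
    ... | yes x∈X = proj₁ (h x∈X) ∷ []
    ... | no  _   = []

    pick-sound : ∀ x {C} → C ∈ˡ pick x → Circuit M C × C ⊆ X
    pick-sound x C∈ with x ∈? X
    pick-sound x (here refl) | yes x∈X =
      let _ , circ , _ , C⊆X = h x∈X in circ , C⊆X

    pick-covers : ∀ {x} → x ∈ X → ∃ λ C → C ∈ˡ pick x × x ∈ C
    pick-covers {x} x∈X with x ∈? X
    ... | yes x∈X′ = proj₁ (h x∈X′) , here refl , proj₁ (proj₂ (proj₂ (h x∈X′)))
    ... | no  x∉X  = ⊥-elim (x∉X x∈X)

    sound : ∀ {C} → C ∈ˡ concatMap pick (allFin n) → Circuit M C × C ⊆ X
    sound C∈ with x , C∈x ← Any.satisfied (∈-concatMap⁻ pick {xs = allFin n} C∈) =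
      pick-sound x C∈x

    sub : ⋃ (concatMap pick (allFin n)) ⊆ X
    sub x∈ with C , C∈ , x∈C ← ∈-⋃⁻ (concatMap pick (allFin n)) x∈ =
      proj₂ (sound C∈) x∈C

    sup : X ⊆ ⋃ (concatMap pick (allFin n))
    sup {x} x∈X with C , C∈ , x∈C ← pick-covers x∈X =
      ∈-⋃⁺ (∈-concatMap⁺ pick (Any.map (λ { refl → C∈ }) (∈-allFin x))) x∈C

  ∪-cyclic : ∀ {X Y} → Cyclic M X → Cyclic M Y → Cyclic M (X ∪ Y)
  ∪-cyclic {X} {Y} cX cY = cyclic⁺ go
    where
    go : ∀ {x} → x ∈ X ∪ Y → ∃ λ C → Circuit M C × x ∈ C × C ⊆ X ∪ Y
    go x∈ with x∈p∪q⁻ X Y x∈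
    ... | inj₁ x∈X = let C , circ , x∈C , C⊆ = cyclic⁻ cX x∈X in C , circ , x∈C , p⊆p∪q Y ∘ C⊆
    ... | inj₂ x∈Y = let C , circ , x∈C , C⊆ = cyclic⁻ cY x∈Y in C , circ , x∈C , q⊆p∪q X Y ∘ C⊆

  cl-cyclic : ∀ {X} → Cyclic M X → Cyclic M (cl M X)
  cl-cyclic {X} cX = cyclic⁺ go
    where
    go : ∀ {x} → x ∈ cl M X → ∃ λ C → Circuit M C × x ∈ C × C ⊆ cl M X
    go {x} x∈cl with x ∈? X
    ... | yes x∈X = let C , circ , x∈C , C⊆ = cyclic⁻ cX x∈X in C , circ , x∈C , X⊆clX X ∘ C⊆
    ... | no x∉X
      with B , B⊆X , indB , eqB ← rank-attained X
      with C , C⊆ , circ ← dependent⇒circuit (B ∪ ⁅ x ⁆)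
                             (basis-maximal B⊆X eqB x∈cl (x∉X ∘ B⊆X))
      with x ∈? C
    ... | yes x∈C = C , circ , x∈C , ⊆-trans C⊆ (∪-lub (X⊆clX X ∘ B⊆X) (⁅⁆⊆ x∈cl))
    ... | no  x∉C = ⊥-elim (proj₁ circ (hereditary C⊆B indB))
      where
      C⊆B : C ⊆ B
      C⊆B {y} y∈C with x∈p∪q⁻ B ⁅ x ⁆ (C⊆ y∈C)
      ... | inj₁ y∈B = y∈B
      ... | inj₂ y∈x = ⊥-elim (x∉C (subst (_∈ C) (x∈⁅y⁆⇒x≡y x y∈x) y∈C))

  join : 𝒵 M → 𝒵 M → 𝒵 M
  join (F , [ zF ]) (G , [ zG ]) =
    cl M (F ∪ G) , [ cl-cyclic (∪-cyclic (proj₁ zF) (proj₁ zG)) , cl-flat (F ∪ G) ]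

module _ {n s : ℕ} (A : Fin s → Subset n) where

  PartialTransversal : Pred (Subset n) 0ℓ
  PartialTransversal I = ∃ λ (ψ : ∃ (_∈ I) ↣ Fin s) →
                         ∀ x → proj₁ x ∈ A (Injection.to ψ x)

  Presents : Matroid n → Set
  Presents M = ∀ I → Matroid.Indep M I ⇔ PartialTransversal I

  others : Fin s → Subset n
  others i = ⋃ (map A (filter (λ j → ¬? (j ≟ i)) (allFin s)))

FundamentalTransversal : ∀ {n} → Matroid n → Set
FundamentalTransversal {n} M =
  ∃₂ λ (s : ℕ) (A : Fin s → Subset n) →
    Presents A M × (∀ i → Nonempty (A i ─ others A i))

module _ {n : ℕ} (M : Matroid n) where

  -- A subset of the finite set 𝒵 M is given by a list of its members; order and
  -- repetitions do not matter, as only membership and intersections are used.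
  Family : Set
  Family = List (𝒵 M)

  Filter : Pred Family 0ℓ
  Filter 𝓕 = ∀ {A B} → A ∈ˡ 𝓕 → value A ⊆ value B → B ∈ˡ 𝓕

  Antichain : Pred Family 0ℓ
  Antichain 𝓕 = ∀ {A B} → A ∈ˡ 𝓕 → B ∈ˡ 𝓕 → value A ⊆ value B → A ≡ B

  module _ {r : ℕ} (φ : 𝒵 M → Subset r) where

    CardIsRank : Set
    CardIsRank = ∀ F → ∣ φ F ∣ ≡ rank M (value F)

    JoinToUnion : Set
    JoinToUnion = ∀ F G → φ (join M F G) ≡ φ F ∪ φ G

    -- ⋂ [] is the full set, both in the ground set and in Fin r.
    MeetRank : Pred Family 0ℓ → Set
    MeetRank 𝒞 = ∀ 𝓕 → 𝒞 𝓕 → rank M (⋂ (map value 𝓕)) ≡ ∣ ⋂ (map φ 𝓕) ∣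

{-# OPTIONS --safe #-}
-- Given a presentation whose sets A i have private elements b i, put φ F = {i : b i ∈ F}.
-- For a cyclic flat F this is the set of i with F ∩ A i ≠ ∅, so the rank of an
-- intersection of cyclic flats counts the b i in it.
--
-- Conversely, for an index i let D be the intersection of the cyclic flats F with i ∈ φ F
-- and H the join of those with i ∉ φ F.  By (3), D - H is at least as large as
-- the set of indices that lie in the same sets φ F as i.  Hence there are distinct b i with
-- b i ∈ F ⇔ i ∈ φ F.  These form a basis, every cyclic flat F is spanned by the b i in it,
-- and the complements of the flats spanned by {b j : j ≠ i} present M.
--
-- For filters and antichains: by (2) φ is monotone, so neither side of (3) changes if
-- the family is replaced by its up-closure or by its minimal members.
module Submission where

open import Defs
import Data.Bool.Properties as Bool
open import Data.Fin using (Fin; zero; suc; _≟_)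
open import Data.Fin.Properties using (any?; suc-injective)
open import Data.Fin.Subset
open import Data.Fin.Subset.Properties
open import Data.Irrelevant using ([_])
open import Data.List using (List; []; _∷_; map; filter; foldr; allFin; concatMap)
open import Data.List.Membership.Propositional using (find; lose) renaming (_∈_ to _∈ˡ_)
open import Data.List.Membership.Propositional.Properties
  using (∈-map⁺; ∈-map⁻; ∈-filter⁺; ∈-filter⁻; ∈-concatMap⁺; ∈-allFin)
open import Data.List.Properties using (filter-≐)
open import Data.List.Relation.Unary.All using ([]; _∷_)
open import Data.List.Relation.Unary.Any as Any using (Any; here; there)
open import Data.Nat using (ℕ; zero; suc; _+_; _≤_; _<_; z≤n; s≤s; z<s; s<s; s<s⁻¹)
open import Data.Nat.Induction using (<-wellFounded)
import Data.Nat.Properties as ℕ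
open import Data.Product using (∃; _×_; _,_; proj₁; proj₂)
open import Data.Refinement using (value; _,_; value-injective)
open import Data.Sum using (_⊎_; inj₁; inj₂; [_,_]′)
open import Data.Vec using (tabulate; []; _∷_; here; there)
open import Data.Vec.Properties using (lookup∘tabulate; []=⇒lookup; lookup⇒[]=; ≡-dec)
open import Data.Vec.Properties.WithK using ([]=-irrelevant)
open import Function using (_∘_; _$_)
open import Function.Bundles using (_⇔_; _↣_; mk⇔; mk↣; module Equivalence; module Injection)
open import Induction.WellFounded using (Acc; acc)
open import Level using (0ℓ)
open import Relation.Binary.PropositionalEquality
  using (_≡_; _≢_; refl; sym; trans; cong; cong₂; subst; subst₂; module ≡-Reasoning)
open import Relation.Nullary using (¬_; Dec; yes; no; does; ¬?; _×-dec_; recompute; contradiction)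
open import Relation.Nullary.Decidable using (dec-true; map′; decidable-stable)
open import Relation.Unary using (Pred; Decidable; U)
open Injection using (to)

-- Finite sets: counting and enumerating members.

private variable
  m n : ℕ

⟪_⟫ : {P : Pred (Fin n) 0ℓ} → Decidable P → Subset n
⟪ P? ⟫ = tabulate (does ∘ P?)

∈⟪⟫⁺ : {P : Pred (Fin n) 0ℓ} (P? : Decidable P) {x : Fin n} → P x → x ∈ ⟪ P? ⟫
∈⟪⟫⁺ P? {x} px = lookup⇒[]= x _ (trans (lookup∘tabulate _ x) (dec-true (P? x) px))

∈⟪⟫⁻ : {P : Pred (Fin n) 0ℓ} (P? : Decidable P) {x : Fin n} → x ∈ ⟪ P? ⟫ → P x
∈⟪⟫⁻ P? {x} x∈ = dec-true⁻ (P? x) (trans (sym (lookup∘tabulate _ x)) ([]=⇒lookup x∈))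

x∈p─q⇒x∉q : ∀ {x : Fin n} (p q : Subset n) → x ∈ p ─ q → x ∉ q
x∈p─q⇒x∉q (_ ∷ p) (outside ∷ q) (there x∈) (there x∈q) = x∈p─q⇒x∉q p q x∈ x∈q
x∈p─q⇒x∉q (_ ∷ p) (inside  ∷ q) (there x∈) (there x∈q) = x∈p─q⇒x∉q p q x∈ x∈q

y∈p-x⇒y≢x : ∀ {x y : Fin n} (p : Subset n) → y ∈ p - x → y ≢ x
y∈p-x⇒y≢x p y∈ refl = x∈p─q⇒x∉q p _ y∈ (x∈⁅x⁆ _)

x∈p∪⁅x⁆ : ∀ {x : Fin n} (p : Subset n) → x ∈ p ∪ ⁅ x ⁆
x∈p∪⁅x⁆ {x = x} p = q⊆p∪q p ⁅ x ⁆ (x∈⁅x⁆ x)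

p⊆p-x∪⁅x⁆ : ∀ (x : Fin n) {p} → p ⊆ (p - x) ∪ ⁅ x ⁆
p⊆p-x∪⁅x⁆ x {p} {y} y∈p with y ≟ x
... | yes refl = x∈p∪⁅x⁆ (p - x)
... | no y≢x = p⊆p∪q _ (x∈p∧x≢y⇒x∈p-y y∈p y≢x)

p⊆q∧∣q∣≤∣p∣⇒p≡q : {p q : Subset n} → p ⊆ q → ∣ q ∣ ≤ ∣ p ∣ → p ≡ q
p⊆q∧∣q∣≤∣p∣⇒p≡q {p = p} {q} p⊆q le = ⊆-antisym p⊆q λ {x} x∈q →
  decidable-stable (x ∈? p) λ x∉p → ℕ.<⇒≱ (p⊂q⇒∣p∣<∣q∣ (p⊆q , x , x∈q , x∉p)) le

-- `f` takes a membership proof so that it need be defined only on `p`. The value at the first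
-- member is deleted from `q` before the others are counted.
injection⇒∣∣≤∣∣ : (p : Subset m) (q : Subset n) (f : ∀ x → x ∈ p → Fin n) →
                  (∀ x x∈p → f x x∈p ∈ q) →
                  (∀ {x y} x∈p y∈p → f x x∈p ≡ f y y∈p → x ≡ y) → ∣ p ∣ ≤ ∣ q ∣
injection⇒∣∣≤∣∣ [] q f f∈q inj = z≤n
injection⇒∣∣≤∣∣ (outside ∷ p) q f f∈q inj =
  injection⇒∣∣≤∣∣ p q (λ x x∈p → f (suc x) (there x∈p)) (λ _ _ → f∈q _ _)
    (λ x∈p y∈p → suc-injective ∘ inj (there x∈p) (there y∈p))
injection⇒∣∣≤∣∣ (inside ∷ p) q f f∈q inj = ℕ.≤-<-trans
  (injection⇒∣∣≤∣∣ p (q - f zero here) (λ x x∈p → f (suc x) (there x∈p))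
    (λ x x∈p → x∈p∧x≢y⇒x∈p-y (f∈q _ _) λ eq → contradiction (inj (there x∈p) here eq) λ ())
    (λ x∈p y∈p → suc-injective ∘ inj (there x∈p) (there y∈p)))
  (x∈p⇒∣p-x∣<∣p∣ (f∈q zero here))

∣p∣≡∣p∩q∣+∣p─q∣ : (p q : Subset n) → ∣ p ∣ ≡ ∣ p ∩ q ∣ + ∣ p ─ q ∣
∣p∣≡∣p∩q∣+∣p─q∣ [] [] = refl
∣p∣≡∣p∩q∣+∣p─q∣ (outside ∷ p) (inside  ∷ q) = ∣p∣≡∣p∩q∣+∣p─q∣ p q
∣p∣≡∣p∩q∣+∣p─q∣ (outside ∷ p) (outside ∷ q) = ∣p∣≡∣p∩q∣+∣p─q∣ p q
∣p∣≡∣p∩q∣+∣p─q∣ (inside  ∷ p) (inside  ∷ q) = cong suc (∣p∣≡∣p∩q∣+∣p─q∣ p q)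
∣p∣≡∣p∩q∣+∣p─q∣ (inside  ∷ p) (outside ∷ q) =
  trans (cong suc (∣p∣≡∣p∩q∣+∣p─q∣ p q)) (sym (ℕ.+-suc _ _))

∣p∪⁅x⁆∣≤1+∣p∣ : (p : Subset n) (x : Fin n) → ∣ p ∪ ⁅ x ⁆ ∣ ≤ suc ∣ p ∣
∣p∪⁅x⁆∣≤1+∣p∣ p x = begin
  ∣ p ∪ ⁅ x ⁆ ∣                                    ≡⟨ ∣p∣≡∣p∩q∣+∣p─q∣ (p ∪ ⁅ x ⁆) ⁅ x ⁆ ⟩
  ∣ (p ∪ ⁅ x ⁆) ∩ ⁅ x ⁆ ∣ + ∣ (p ∪ ⁅ x ⁆) - x ∣    ≤⟨ ℕ.+-mono-≤
                                                       (∣p∩q∣≤∣q∣ (p ∪ ⁅ x ⁆) ⁅ x ⁆)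
                                                       (p⊆q⇒∣p∣≤∣q∣ sub) ⟩
  ∣ ⁅ x ⁆ ∣ + ∣ p ∣                                ≡⟨ cong (_+ ∣ p ∣) (∣⁅x⁆∣≡1 x) ⟩
  suc ∣ p ∣                                        ∎
  where
  open ℕ.≤-Reasoning
  sub : (p ∪ ⁅ x ⁆) - x ⊆ p
  sub y∈ with x∈p∪q⁻ p ⁅ x ⁆ (p─q⊆p _ _ y∈)
  ... | inj₁ y∈p = y∈p
  ... | inj₂ y∈x = contradiction (x∈⁅y⁆⇒x≡y x y∈x) (y∈p-x⇒y≢x (p ∪ ⁅ x ⁆) y∈)

-- The number of members of `p` smaller than `x`, whether or not `x ∈ p`.
position : Subset n → Fin n → ℕ
position (_ ∷ p)       zero    = 0
position (inside  ∷ p) (suc x) = suc (position p x)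
position (outside ∷ p) (suc x) = position p x

position<∣∣ : ∀ {p : Subset n} {x} → x ∈ p → position p x < ∣ p ∣
position<∣∣ here = z<s
position<∣∣ {p = inside  ∷ _} (there x∈p) = s<s (position<∣∣ x∈p)
position<∣∣ {p = outside ∷ _} (there x∈p) = position<∣∣ x∈p

position-injective : ∀ {p : Subset n} {x y} → x ∈ p → y ∈ p →
                     position p x ≡ position p y → x ≡ y
position-injective here here eq = refl
position-injective {p = inside ∷ _} (there x∈p) (there y∈p) eq =
  cong suc (position-injective x∈p y∈p (ℕ.suc-injective eq))
position-injective {p = outside ∷ _} (there x∈p) (there y∈p) eq =
  cong suc (position-injective x∈p y∈p eq)

nth : (p : Subset n) (k : ℕ) → k < ∣ p ∣ → ∃ λ x → x ∈ p × position p x ≡ k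
nth (outside ∷ p) k       k< = let x , x∈p , eq = nth p k k< in suc x , there x∈p , eq
nth (inside  ∷ p) zero    k< = zero , here , refl
nth (inside  ∷ p) (suc k) k< =
  let x , x∈p , eq = nth p k (s<s⁻¹ k<) in suc x , there x∈p , cong suc eq

-- Intersections of families and images of index sets.

module _ {A : Set} (f : A → Subset n) where

  ∈-⋂⁺ : ∀ {x} L → (∀ {F} → F ∈ˡ L → x ∈ f F) → x ∈ ⋂ (map f L)
  ∈-⋂⁺ []      h = ∈⊤
  ∈-⋂⁺ (F ∷ L) h = x∈p∩q⁺ (h (here refl) , ∈-⋂⁺ L (h ∘ there))

  ∈-⋂⁻ : ∀ {x} L → x ∈ ⋂ (map f L) → ∀ {F} → F ∈ˡ L → x ∈ f F
  ∈-⋂⁻ (F ∷ L) x∈ (here refl) = proj₁ (x∈p∩q⁻ (f F) _ x∈)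
  ∈-⋂⁻ (F ∷ L) x∈ (there F∈)  = ∈-⋂⁻ L (proj₂ (x∈p∩q⁻ (f F) _ x∈)) F∈

  ⋂-mono : ∀ L K → (∀ {F} → F ∈ˡ K → ∃ λ G → G ∈ˡ L × f G ⊆ f F) →
           ⋂ (map f L) ⊆ ⋂ (map f K)
  ⋂-mono L K h x∈ = ∈-⋂⁺ K λ F∈K → let G , G∈L , G⊆F = h F∈K in G⊆F (∈-⋂⁻ L x∈ G∈L)

module _ (b : Fin m → Fin n) where

  preimage? : ∀ S → Decidable (λ x → ∃ λ i → i ∈ S × b i ≡ x)
  preimage? S x = any? λ i → (i ∈? S) ×-dec (b i ≟ x)

  image : Subset m → Subset n
  image S = ⟪ preimage? S ⟫

  ∈-image⁺ : ∀ {S i} → i ∈ S → b i ∈ image S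
  ∈-image⁺ i∈S = ∈⟪⟫⁺ (preimage? _) (_ , i∈S , refl)

  ∈-image⁻ : ∀ {S x} → x ∈ image S → ∃ λ i → i ∈ S × b i ≡ x
  ∈-image⁻ = ∈⟪⟫⁻ (preimage? _)

  image⊆ : ∀ {S X} → (∀ {i} → i ∈ S → b i ∈ X) → image S ⊆ X
  image⊆ h x∈ with i , i∈S , refl ← ∈-image⁻ x∈ = h i∈S

  image-mono : ∀ {S T} → S ⊆ T → image S ⊆ image T
  image-mono S⊆T = image⊆ (∈-image⁺ ∘ S⊆T)

  ∣∣≤∣image∣ : (∀ {i j} → b i ≡ b j → i ≡ j) → ∀ S → ∣ S ∣ ≤ ∣ image S ∣
  ∣∣≤∣image∣ inj S = injection⇒∣∣≤∣∣ S _ (λ i _ → b i) (λ _ → ∈-image⁺) (λ _ _ → inj)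

-- Rank, closure and exchange in a matroid.

module _ {n : ℕ} (M : Matroid n) where
  open Matroid M

  ∣∣≤rank⇒indep : ∀ {X} → ∣ X ∣ ≤ rank M X → Indep X
  ∣∣≤rank⇒indep {X} le with I , I⊆X , ind , eq ← rank-attained M X =
    subst Indep (p⊆q∧∣q∣≤∣p∣⇒p≡q I⊆X (ℕ.≤-trans le (ℕ.≤-reflexive (sym eq)))) ind

  rank≤∣∣ : ∀ X → rank M X ≤ ∣ X ∣
  rank≤∣∣ X with I , I⊆X , ind , eq ← rank-attained M X =
    subst (_≤ ∣ X ∣) eq (p⊆q⇒∣p∣≤∣q∣ I⊆X)

  -- A largest independent subset of `X` is cut along `Y`; its part outside `Y` is bounded by size
  -- alone.
  rank-split : ∀ X Y → rank M X ≤ rank M (X ∩ Y) + ∣ X ─ Y ∣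
  rank-split X Y with I , I⊆X , ind , eq ← rank-attained M X = begin
    rank M X                       ≡⟨ eq ⟨
    ∣ I ∣                          ≡⟨ ∣p∣≡∣p∩q∣+∣p─q∣ I Y ⟩
    ∣ I ∩ Y ∣ + ∣ I ─ Y ∣          ≤⟨ ℕ.+-mono-≤
                                       (indep⇒∣∣≤rank M
                                         (λ x∈ → let x∈I , x∈Y = x∈p∩q⁻ I Y x∈ in x∈p∩q⁺ (I⊆X x∈I , x∈Y))
                                         (hereditary (p∩q⊆p I Y) ind))
                                       (p⊆q⇒∣p∣≤∣q∣ λ x∈ →
                                         x∈p∧x∉q⇒x∈p─q (I⊆X (p─q⊆p I Y x∈)) (x∈p─q⇒x∉q I Y x∈)) ⟩
    rank M (X ∩ Y) + ∣ X ─ Y ∣     ∎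
    where open ℕ.≤-Reasoning

  rank-∪⁅⁆ : ∀ X x → rank M (X ∪ ⁅ x ⁆) ≤ suc (rank M X)
  rank-∪⁅⁆ X x with I , I⊆ , ind , eq ← rank-attained M (X ∪ ⁅ x ⁆) = begin
    rank M (X ∪ ⁅ x ⁆)        ≡⟨ eq ⟨
    ∣ I ∣                     ≤⟨ p⊆q⇒∣p∣≤∣q∣ (p⊆p-x∪⁅x⁆ x {I}) ⟩
    ∣ (I - x) ∪ ⁅ x ⁆ ∣       ≤⟨ ∣p∪⁅x⁆∣≤1+∣p∣ (I - x) x ⟩
    suc ∣ I - x ∣             ≤⟨ s≤s (indep⇒∣∣≤rank M I-x⊆X (hereditary (p─q⊆p I _) ind)) ⟩
    suc (rank M X)            ∎
    where
    open ℕ.≤-Reasoning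
    I-x⊆X : I - x ⊆ X
    I-x⊆X y∈ with x∈p∪q⁻ X ⁅ x ⁆ (I⊆ (p─q⊆p I _ y∈))
    ... | inj₁ y∈X = y∈X
    ... | inj₂ y∈x = contradiction (x∈⁅y⁆⇒x≡y x y∈x) (y∈p-x⇒y≢x I y∈)

  ∉cl⇒rank< : ∀ {X x} → x ∉ cl M X → rank M X < rank M (X ∪ ⁅ x ⁆)
  ∉cl⇒rank< {X} x∉ = ℕ.≤∧≢⇒< (rank-mono M (p⊆p∪q _)) λ eq → x∉ (∈-cl⁺ M X (sym eq))

  indep∪⁅⁆ : ∀ {I x} → Indep I → x ∉ cl M I → Indep (I ∪ ⁅ x ⁆)
  indep∪⁅⁆ {I} {x} ind x∉ = ∣∣≤rank⇒indep $ begin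
    ∣ I ∪ ⁅ x ⁆ ∣         ≤⟨ ∣p∪⁅x⁆∣≤1+∣p∣ I x ⟩
    suc ∣ I ∣             ≤⟨ s≤s (indep⇒∣∣≤rank M ⊆-refl ind) ⟩
    suc (rank M I)        ≤⟨ ∉cl⇒rank< x∉ ⟩
    rank M (I ∪ ⁅ x ⁆)    ∎
    where open ℕ.≤-Reasoning

  indep⇒∉cl : ∀ {I x} → Indep (I ∪ ⁅ x ⁆) → x ∉ I → x ∉ cl M I
  indep⇒∉cl {I} {x} ind x∉I x∈cl = ℕ.<⇒≱ (∣I∪x∣ M x∉I) $ begin
    ∣ I ∪ ⁅ x ⁆ ∣         ≤⟨ indep⇒∣∣≤rank M ⊆-refl ind ⟩
    rank M (I ∪ ⁅ x ⁆)    ≡⟨ ∈-cl⁻ M I x∈cl ⟩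
    rank M I              ≤⟨ rank≤∣∣ I ⟩
    ∣ I ∣                 ∎
    where open ℕ.≤-Reasoning

  extend-to-basis : ∀ {I X} → I ⊆ X → Indep I →
                    ∃ λ B → I ⊆ B × B ⊆ X × Indep B × ∣ B ∣ ≡ rank M X
  extend-to-basis {I} {X} I⊆X ind = go (rank M X) I I⊆X ind (ℕ.m≤m+n _ _)
    where
    -- `k` bounds the number of elements still to be added, which makes the recursion structural.
    go : ∀ k I → I ⊆ X → Indep I → rank M X ≤ k + ∣ I ∣ →
         ∃ λ B → I ⊆ B × B ⊆ X × Indep B × ∣ B ∣ ≡ rank M X
    go zero I I⊆X ind le = I , ⊆-refl , I⊆X , ind , ℕ.≤-antisym (indep⇒∣∣≤rank M I⊆X ind) le
    go (suc k) I I⊆X ind le with ∣ I ∣ ℕ.<? rank M X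
    ... | no ≮ = I , ⊆-refl , I⊆X , ind , ℕ.≤-antisym (indep⇒∣∣≤rank M I⊆X ind) (ℕ.≮⇒≥ ≮)
    ... | yes lt
      with J , J⊆X , indJ , eqJ ← rank-attained M X
      with x , x∈J , x∉I , ind′ ← augment ind indJ (subst (∣ I ∣ <_) (sym eqJ) lt) =
      let B , I∪x⊆B , rest = go k (I ∪ ⁅ x ⁆) (∪-lub I⊆X (⁅⁆⊆ (J⊆X x∈J))) ind′
            (ℕ.≤-trans le (ℕ.≤-trans (ℕ.≤-reflexive (sym (ℕ.+-suc k _)))
                                     (ℕ.+-monoʳ-≤ k (∣I∪x∣ M x∉I))))
      in B , ⊆-trans (p⊆p∪q _) I∪x⊆B , rest

  -- If `x ∉ cl M Y`, extend a largest independent `I ⊆ X` to a largest independent `B ⊆ Y`. By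
  -- `bound`, `x ∉ cl M B`, so `B ∪ ⁅ x ⁆` and hence `I ∪ ⁅ x ⁆` is independent, against the
  -- maximality of `I`.
  cl-mono : ∀ {X Y} → X ⊆ Y → cl M X ⊆ cl M Y
  cl-mono {X} {Y} X⊆Y {x} x∈clX = decidable-stable (x ∈? cl M Y) λ x∉clY →
    let I , I⊆X , indI , eqI = rank-attained M X
        B , I⊆B , B⊆Y , indB , eqB = extend-to-basis (⊆-trans I⊆X X⊆Y) indI
        x∉clB = λ x∈clB → x∉clY (∈-cl⁺ M Y (ℕ.≤-antisym (bound B B⊆Y indB eqB x∈clB)
                                                      (rank-mono M (p⊆p∪q _))))
    in basis-maximal M I⊆X eqI x∈clX (x∉clY ∘ X⊆clX M Y ∘ X⊆Y ∘ I⊆X)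
         (hereditary (∪-lub (p⊆p∪q _ ∘ I⊆B) (q⊆p∪q B _)) (indep∪⁅⁆ indB x∉clB))
    where
    -- An element augmenting `B` would come from `Y`, where `B` is already largest, or be `x`, which
    -- `B` already spans.
    bound : ∀ B → B ⊆ Y → Indep B → ∣ B ∣ ≡ rank M Y → x ∈ cl M B →
            rank M (Y ∪ ⁅ x ⁆) ≤ rank M Y
    bound B B⊆Y indB eqB x∈clB = ℕ.≮⇒≥ λ lt →
      let J , J⊆ , indJ , eqJ = rank-attained M (Y ∪ ⁅ x ⁆)
          y , y∈J , y∉B , indBy = augment indB indJ (subst₂ _<_ (sym eqB) (sym eqJ) lt)
      in case y∉B indBy (x∈p∪q⁻ Y _ (J⊆ y∈J))
      where
      case : ∀ {y} → y ∉ B → Indep (B ∪ ⁅ y ⁆) → ¬ (y ∈ Y ⊎ y ∈ ⁅ x ⁆)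
      case y∉B ind (inj₁ y∈Y) = ℕ.<⇒≱ (∣I∪x∣ M y∉B)
        (ℕ.≤-trans (indep⇒∣∣≤rank M (∪-lub B⊆Y (⁅⁆⊆ y∈Y)) ind) (ℕ.≤-reflexive (sym eqB)))
      case y∉B ind (inj₂ y∈x) with refl ← x∈⁅y⁆⇒x≡y x y∈x = indep⇒∉cl ind y∉B x∈clB

  cl⊆flat : ∀ {X F} → X ⊆ F → Flat M F → cl M X ⊆ F
  cl⊆flat X⊆F flat = ⊆-trans (cl-mono X⊆F) (⊆-reflexive flat)

  cl⊆cl : ∀ {X Y} → X ⊆ cl M Y → cl M X ⊆ cl M Y
  cl⊆cl {Y = Y} X⊆ = cl⊆flat X⊆ (cl-flat M Y)

  -- Adding `x` raises the rank of `X` by at most one, adding `y` by at least one, and adding `y`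
  -- after `x` changes nothing.
  cl-exchange : ∀ {X x y} → y ∈ cl M (X ∪ ⁅ x ⁆) → y ∉ cl M X → x ∈ cl M (X ∪ ⁅ y ⁆)
  cl-exchange {X} {x} {y} y∈ y∉ = ∈-cl⁺ M _ $ ℕ.≤-antisym le (rank-mono M (p⊆p∪q _))
    where
    open ℕ.≤-Reasoning
    le : rank M ((X ∪ ⁅ y ⁆) ∪ ⁅ x ⁆) ≤ rank M (X ∪ ⁅ y ⁆)
    le = begin
      rank M ((X ∪ ⁅ y ⁆) ∪ ⁅ x ⁆)   ≤⟨ rank-mono M (∪-lub
                                          (∪-lub (p⊆p∪q _ ∘ p⊆p∪q _) (q⊆p∪q (X ∪ ⁅ x ⁆) _))
                                          (p⊆p∪q _ ∘ q⊆p∪q X _)) ⟩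
      rank M ((X ∪ ⁅ x ⁆) ∪ ⁅ y ⁆)   ≡⟨ ∈-cl⁻ M (X ∪ ⁅ x ⁆) y∈ ⟩
      rank M (X ∪ ⁅ x ⁆)             ≤⟨ rank-∪⁅⁆ X x ⟩
      suc (rank M X)                 ≤⟨ ∉cl⇒rank< y∉ ⟩
      rank M (X ∪ ⁅ y ⁆)             ∎

  rank≤∣∣⇒spans : ∀ {I X} → I ⊆ X → Indep I → rank M X ≤ ∣ I ∣ → X ⊆ cl M I
  rank≤∣∣⇒spans {I} {X} I⊆X ind le {x} x∈X = decidable-stable (x ∈? cl M I) λ x∉ →
    ℕ.<⇒≱ (∣I∪x∣ M (x∉ ∘ X⊆clX M I))
      (ℕ.≤-trans (indep⇒∣∣≤rank M (∪-lub I⊆X (⁅⁆⊆ x∈X)) (indep∪⁅⁆ ind x∉)) le)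

  -- Decidability and enumeration of the cyclic flats.

  circuit? : Decidable (Circuit M)
  circuit? C = ¬? (indep? C) ×-dec
    map′ (λ none {D} D⊂C → decidable-stable (indep? D) λ dep → none (D , D⊂C , dep))
         (λ min (D , D⊂C , dep) → dep (min D⊂C))
         (¬? (anySubset? λ D → (D ⊂? C) ×-dec ¬? (indep? D)))

  -- Lists of circuits cannot be searched exhaustively, but covering each element by a circuit
  -- inside `X` is a search over finitely many subsets.
  cyclic? : Decidable (Cyclic M)
  cyclic? X = map′ (λ none → cyclic⁺ M λ {x} x∈X → decidable-stable (covered? x) λ ¬c → none (x , x∈X , ¬c))
                   (λ cyc (x , x∈X , ¬c) → ¬c (cyclic⁻ M cyc x∈X))
                   (¬? (any? λ x → (x ∈? X) ×-dec ¬? (covered? x)))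
    where
    covered? : ∀ x → Dec (∃ λ C → Circuit M C × x ∈ C × C ⊆ X)
    covered? x = anySubset? λ C → circuit? C ×-dec (x ∈? C) ×-dec (C ⊆? X)

  cyclicFlat? : Decidable (CyclicFlat M)
  cyclicFlat? X = cyclic? X ×-dec ≡-dec Bool._≟_ (cl M X) X

  -- The proof stored in `F` is irrelevant; decidability allows a usable one to be recomputed.
  cyclicFlat : (F : 𝒵 M) → CyclicFlat M (value F)
  cyclicFlat (F , [ zF ]) = recompute (cyclicFlat? F) zF

  flat : (F : 𝒵 M) → Flat M (value F)
  flat = proj₂ ∘ cyclicFlat

  toMembers : ∀ {X} → Dec (CyclicFlat M X) → List (𝒵 M)
  toMembers {X} (yes z) = (X , [ z ]) ∷ []
  toMembers     (no _)  = []

  all𝒵 : List (𝒵 M)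
  all𝒵 = concatMap (λ X → toMembers (cyclicFlat? X)) (subsets n)

  ∈-all𝒵 : ∀ F → F ∈ˡ all𝒵
  ∈-all𝒵 F = ∈-concatMap⁺ _ (Any.map (λ { refl → go (cyclicFlat? (value F)) }) (∈-subsets (value F)))
    where
    go : (d : Dec (CyclicFlat M (value F))) → F ∈ˡ toMembers d
    go (yes _) = here refl
    go (no ¬z) = contradiction (cyclicFlat F) ¬z

  ⊆join₁ : ∀ F G → value F ⊆ value (join M F G)
  ⊆join₁ F G = X⊆clX M _ ∘ p⊆p∪q _

  ⊆join₂ : ∀ F G → value G ⊆ value (join M F G)
  ⊆join₂ F G = X⊆clX M _ ∘ q⊆p∪q (value F) _

  -- The set of loops, which serves as the join of the empty family.
  bottom : 𝒵 M
  bottom = cl M ⊥ , [ cl-cyclic M ([] , [] , refl) , cl-flat M ⊥ ]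

  joins : List (𝒵 M) → 𝒵 M
  joins = foldr (join M) bottom

  ⊆joins : ∀ {F} L → F ∈ˡ L → value F ⊆ value (joins L)
  ⊆joins (F ∷ L) (here refl) = ⊆join₁ F (joins L)
  ⊆joins (G ∷ L) (there F∈L) = ⊆join₂ G (joins L) ∘ ⊆joins L F∈L

  -- Reduction of arbitrary families to filters and antichains.

  module _ {r} (φ : 𝒵 M → Subset r) (join-∪ : JoinToUnion M φ) where

    -- When `F ⊆ G` their join is `G`, so `join-∪` reads `φ G ≡ φ F ∪ φ G`.
    φ-mono : ∀ F G → value F ⊆ value G → φ F ⊆ φ G
    φ-mono F G F⊆G = ⊆-trans (p⊆p∪q _) $ ⊆-reflexive $ trans (sym (join-∪ F G)) $ cong φ $
      value-injective (⊆-antisym (cl⊆flat (∪-lub F⊆G ⊆-refl) (flat G)) (⊆join₂ F G))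

    -- The two families refine each other from below, so they have the same intersection; `φ-mono`
    -- carries this over to their images under `φ`.
    coinitial⇒MeetRank-U : ∀ {𝒞 : Pred (Family M) 0ℓ} →
      (∀ 𝓕 → ∃ λ 𝓖 → 𝒞 𝓖 ×
        (∀ {F} → F ∈ˡ 𝓕 → ∃ λ G → G ∈ˡ 𝓖 × value G ⊆ value F) ×
        (∀ {G} → G ∈ˡ 𝓖 → ∃ λ F → F ∈ˡ 𝓕 × value F ⊆ value G)) →
      MeetRank M φ 𝒞 → MeetRank M φ U
    coinitial⇒MeetRank-U h meet 𝓕 _ with 𝓖 , 𝒞𝓖 , below , above ← h 𝓕 =
      trans (cong (rank M) (⊆-antisym (⋂-mono value 𝓕 𝓖 above) (⋂-mono value 𝓖 𝓕 below))) $
      trans (meet 𝓖 𝒞𝓖) $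
      cong ∣_∣ (⊆-antisym (⋂-mono φ 𝓖 𝓕 (image-φ below)) (⋂-mono φ 𝓕 𝓖 (image-φ above)))
      where
      image-φ : ∀ {𝓐 𝓑 : Family M} →
        (∀ {F} → F ∈ˡ 𝓐 → ∃ λ G → G ∈ˡ 𝓑 × value G ⊆ value F) →
        (∀ {F} → F ∈ˡ 𝓐 → ∃ λ G → G ∈ˡ 𝓑 × φ G ⊆ φ F)
      image-φ h F∈ = let G , G∈ , G⊆F = h F∈ in G , G∈ , φ-mono G _ G⊆F

  above? : ∀ 𝓕 → Decidable (λ (G : 𝒵 M) → Any (λ (F : 𝒵 M) → value F ⊆ value G) 𝓕)
  above? 𝓕 G = Any.any? (λ F → value F ⊆? value G) 𝓕

  up-closure : Family M → Family M
  up-closure 𝓕 = filter (above? 𝓕) all𝒵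

  ∈-up-closure⁺ : ∀ {𝓕 F G} → F ∈ˡ 𝓕 → value F ⊆ value G → G ∈ˡ up-closure 𝓕
  ∈-up-closure⁺ {𝓕} {G = G} F∈ F⊆G = ∈-filter⁺ (above? 𝓕) (∈-all𝒵 G) (lose F∈ F⊆G)

  ∈-up-closure⁻ : ∀ 𝓕 {G} → G ∈ˡ up-closure 𝓕 → ∃ λ F → F ∈ˡ 𝓕 × value F ⊆ value G
  ∈-up-closure⁻ 𝓕 G∈ = find (proj₂ (∈-filter⁻ (above? 𝓕) {xs = all𝒵} G∈))

  up-closure-filter : ∀ 𝓕 → Filter M (up-closure 𝓕)
  up-closure-filter 𝓕 G∈ G⊆H = let F , F∈ , F⊆G = ∈-up-closure⁻ 𝓕 G∈ in
    ∈-up-closure⁺ F∈ (⊆-trans F⊆G G⊆H)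

  minimal? : ∀ 𝓕 → Decidable (λ (F : 𝒵 M) → ¬ Any (λ (G : 𝒵 M) → value G ⊂ value F) 𝓕)
  minimal? 𝓕 F = ¬? (Any.any? (λ G → value G ⊂? value F) 𝓕)

  minimals : Family M → Family M
  minimals 𝓕 = filter (minimal? 𝓕) 𝓕

  minimals⊆ : ∀ 𝓕 {F} → F ∈ˡ minimals 𝓕 → F ∈ˡ 𝓕
  minimals⊆ 𝓕 F∈ = proj₁ (∈-filter⁻ (minimal? 𝓕) F∈)

  minimals-antichain : ∀ 𝓕 → Antichain M (minimals 𝓕)
  minimals-antichain 𝓕 {F} {G} F∈ G∈ F⊆G = value-injective $ ⊆-antisym F⊆G λ {x} x∈G →
    decidable-stable (x ∈? value F) λ x∉F →
      proj₂ (∈-filter⁻ (minimal? 𝓕) {xs = 𝓕} G∈)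
        (lose (minimals⊆ 𝓕 F∈) (F⊆G , x , x∈G , x∉F))

  minimal-below : ∀ 𝓕 {F} → F ∈ˡ 𝓕 → ∃ λ G → G ∈ˡ minimals 𝓕 × value G ⊆ value F
  minimal-below 𝓕 F∈ = go F∈ (<-wellFounded _)
    where
    go : ∀ {F} → F ∈ˡ 𝓕 → Acc _<_ ∣ value F ∣ → ∃ λ G → G ∈ˡ minimals 𝓕 × value G ⊆ value F
    go {F} F∈ (acc rs) with Any.any? (λ G → value G ⊂? value F) 𝓕
    ... | no none = F , ∈-filter⁺ (minimal? 𝓕) F∈ none , ⊆-refl
    ... | yes smaller =
      let G , G∈ , G⊂F = find smaller
          H , H∈ , H⊆G = go G∈ (rs (p⊂q⇒∣p∣<∣q∣ G⊂F))
      in H , H∈ , ⊆-trans H⊆G (proj₁ G⊂F)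

  module _ {r} {b : Fin r → Fin n} (b-injective : ∀ {i j} → b i ≡ b j → i ≡ j)
           (b-indep : Indep (image b ⊤)) where

    ∣∣≤rank : ∀ {S X} → (∀ {i} → i ∈ S → b i ∈ X) → ∣ S ∣ ≤ rank M X
    ∣∣≤rank {S} S→X = ℕ.≤-trans (∣∣≤∣image∣ b b-injective S)
      (indep⇒∣∣≤rank M (image⊆ b S→X) (hereditary (image-mono b ⊆⊤) b-indep))

-- Matchings and partial transversals.

module _ {n s : ℕ} where

  -- `R` is left general so that recursive constructions can forbid indices already in use.
  Matching : (Fin n → Fin s → Set) → Subset n → Set
  Matching R I = ∃ λ (f : ∀ x → x ∈ I → Fin s) →
    (∀ x x∈I → R x (f x x∈I)) × (∀ {x y} x∈I y∈I → f x x∈I ≡ f y y∈I → x ≡ y)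

  map-matching : ∀ {R Q : Fin n → Fin s → Set} {I} →
                 (∀ {x i} → R x i → Q x i) → Matching R I → Matching Q I
  map-matching h (f , fR , f-inj) = f , (λ x x∈I → h (fR x x∈I)) , f-inj

  extend-matching : ∀ {R : Fin n → Fin s → Set} {I x i} → R x i →
                    Matching (λ y j → R y j × j ≢ i) (I - x) → Matching R I
  extend-matching {R} {I} {x} {i} Rxi (f , fR , f-inj) = g , gR , g-inj
    where
    g : ∀ y → y ∈ I → Fin s
    g y y∈I with y ≟ x
    ... | yes _  = i
    ... | no y≢x = f y (x∈p∧x≢y⇒x∈p-y y∈I y≢x)
    gR : ∀ y y∈I → R y (g y y∈I)
    gR y y∈I with y ≟ x
    ... | yes refl = Rxi
    ... | no _     = proj₁ (fR y _)
    g-inj : ∀ {y z} y∈I z∈I → g y y∈I ≡ g z z∈I → y ≡ z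
    g-inj {y} {z} y∈I z∈I eq with y ≟ x | z ≟ x
    ... | yes y≡x | yes z≡x = trans y≡x (sym z≡x)
    ... | yes _   | no _    = contradiction (sym eq) (proj₂ (fR z _))
    ... | no _    | yes _   = contradiction eq (proj₂ (fR y _))
    ... | no _    | no _    = f-inj _ _ eq

module _ {n s} (A : Fin s → Subset n) where

  matching⇒transversal : ∀ {I} → Matching (λ x i → x ∈ A i) I → PartialTransversal A I
  matching⇒transversal (f , f∈A , f-inj) =
    mk↣ {to = λ (x , x∈I) → f x x∈I} (λ { {x , p} {y , q} eq → same-member p q (f-inj p q eq) }) ,
    λ (x , x∈I) → f∈A x x∈I
    where
    -- The injection acts on elements paired with membership proofs, so these proofs must be unique.
    same-member : ∀ {I x y} (p : x ∈ I) (q : y ∈ I) → x ≡ y → (x , p) ≡ (y , q)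
    same-member p q refl = cong (_ ,_) ([]=-irrelevant p q)

  transversal⇒matching : ∀ {I} → PartialTransversal A I → Matching (λ x i → x ∈ A i) I
  transversal⇒matching (ψ , ψ∈A) =
    (λ x x∈I → to ψ (x , x∈I)) , (λ x x∈I → ψ∈A (x , x∈I)) ,
    λ _ _ eq → cong proj₁ (Injection.injective ψ eq)

  disjoint-others : ∀ {x i j} → x ∈ A i ─ others A i → x ∈ A j → j ≡ i
  disjoint-others {x} {i} {j} x∈ x∈Aj = decidable-stable (j ≟ i) λ j≢i →
    x∈p─q⇒x∉q (A i) (others A i) x∈
      (∈-⋃⁺ (∈-map⁺ A (∈-filter⁺ (λ k → ¬? (k ≟ i)) (∈-allFin j) j≢i)) x∈Aj)

-- From a presentation with private elements to `φ`.

module Necessity {n} (M : Matroid n) {s} (A : Fin s → Subset n) (presents : Presents A M)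
                 (private-element : ∀ i → Nonempty (A i ─ others A i)) where
  open Matroid M

  indep⇒matching : ∀ {I} → Indep I → Matching (λ x i → x ∈ A i) I
  indep⇒matching = transversal⇒matching A ∘ Equivalence.to (presents _)

  matching⇒indep : ∀ {I} → Matching (λ x i → x ∈ A i) I → Indep I
  matching⇒indep = Equivalence.from (presents _) ∘ matching⇒transversal A

  b : Fin s → Fin n
  b i = proj₁ (private-element i)

  b∈A : ∀ i → b i ∈ A i
  b∈A i = p─q⊆p (A i) _ (proj₂ (private-element i))

  b∈A⇒≡ : ∀ {i j} → b i ∈ A j → j ≡ i
  b∈A⇒≡ {i} = disjoint-others A (proj₂ (private-element i))

  b-injective : ∀ {i j} → b i ≡ b j → i ≡ j
  b-injective {i} {j} eq = b∈A⇒≡ (subst (_∈ A i) eq (b∈A i))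

  b-indep : Indep (image b ⊤)
  b-indep = matching⇒indep
    ( (λ x x∈ → proj₁ (∈-image⁻ b x∈))
    , (λ x x∈ → let i , _ , bi≡x = ∈-image⁻ b x∈ in subst (_∈ A i) bi≡x (b∈A i))
    , λ x∈ y∈ eq → trans (sym (proj₂ (proj₂ (∈-image⁻ b x∈))))
                         (trans (cong b eq) (proj₂ (proj₂ (∈-image⁻ b y∈)))) )

  -- A largest independent subset of `X` is matched injectively into `J`. Together with `∣∣≤rank`
  -- this pins ranks down from both sides.
  rank≤∣∣ᴬ : ∀ {X J} → (∀ {x i} → x ∈ X → x ∈ A i → i ∈ J) → rank M X ≤ ∣ J ∣
  rank≤∣∣ᴬ {X} {J} X→J
    with I , I⊆X , indI , eq ← rank-attained M X
    with f , f∈A , f-inj ← indep⇒matching indI =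
    subst (_≤ ∣ J ∣) eq
      (injection⇒∣∣≤∣∣ I J f (λ x x∈I → X→J (I⊆X x∈I) (f∈A x x∈I)) f-inj)

  φ : 𝒵 M → Subset s
  φ F = ⟪ (λ i → b i ∈? value F) ⟫

  b∈⇒∈φ : ∀ F {i} → b i ∈ value F → i ∈ φ F
  b∈⇒∈φ F = ∈⟪⟫⁺ (λ i → b i ∈? value F)

  ∈φ⇒b∈ : ∀ F {i} → i ∈ φ F → b i ∈ value F
  ∈φ⇒b∈ F = ∈⟪⟫⁻ (λ i → b i ∈? value F)

  -- If b i ∉ F, take a circuit C of F through x.  In a matching of (C - x) ∪ ⁅ b i ⁆
  -- the element b i can only be matched to i; giving i to x instead matches all of C.
  meets⇒∈φ : ∀ F {x i} → x ∈ value F → x ∈ A i → i ∈ φ F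
  meets⇒∈φ F {x} {i} x∈F x∈Ai = b∈⇒∈φ F $ decidable-stable (b i ∈? value F) λ bi∉F →
    let C , circ , x∈C , C⊆F = cyclic⁻ M (proj₁ (cyclicFlat M F)) x∈F
        bi∉cl = bi∉F ∘ cl⊆flat M (C⊆F ∘ p─q⊆p C _) (flat M F)
    in proj₁ circ $ matching⇒indep $ extend-matching x∈Ai $ restrict C (bi∉F ∘ C⊆F) $
       indep⇒matching $ indep∪⁅⁆ M (proj₂ circ (x∈p⇒p-x⊂p x∈C)) bi∉cl
    where
    restrict : ∀ C → b i ∉ C → Matching (λ y j → y ∈ A j) ((C - x) ∪ ⁅ b i ⁆) →
               Matching (λ y j → y ∈ A j × j ≢ i) (C - x)
    restrict C bi∉C (f , f∈A , f-inj) =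
      (λ y y∈ → f y (p⊆p∪q _ y∈)) ,
      (λ y y∈ → f∈A y _ , λ eq → bi∉C $ p─q⊆p C _ $
        subst (_∈ C - x) (f-inj _ (x∈p∪⁅x⁆ (C - x)) (trans eq (sym (b∈A⇒≡ (f∈A (b i) _))))) y∈) ,
      λ _ _ → f-inj _ _

  s≡rank : s ≡ rank M ⊤
  s≡rank = ℕ.≤-antisym
    (subst (_≤ rank M ⊤) (∣⊤∣≡n s) (∣∣≤rank M b-injective b-indep {S = ⊤} {X = ⊤} λ _ → ∈⊤))
    (subst (rank M ⊤ ≤_) (∣⊤∣≡n s) (rank≤∣∣ᴬ {X = ⊤} {J = ⊤} λ _ _ → ∈⊤))

  card : CardIsRank M φ
  card F = ℕ.≤-antisym (∣∣≤rank M b-injective b-indep (∈φ⇒b∈ F)) (rank≤∣∣ᴬ (meets⇒∈φ F))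

  -- One inclusion is monotonicity. Equality follows by size: a set `A i` meeting `F ∪ G` meets `F`
  -- or `G`, which bounds the rank of the join.
  join-∪ : JoinToUnion M φ
  join-∪ F G = sym $ p⊆q∧∣q∣≤∣p∣⇒p≡q
    (∪-lub (b∈⇒∈φ (join M F G) ∘ ⊆join₁ M F G ∘ ∈φ⇒b∈ F)
           (b∈⇒∈φ (join M F G) ∘ ⊆join₂ M F G ∘ ∈φ⇒b∈ G)) $ begin
    ∣ φ (join M F G) ∣             ≡⟨ card (join M F G) ⟩
    rank M (value (join M F G))    ≤⟨ rank-cl M (value F ∪ value G) ⟩
    rank M (value F ∪ value G)     ≤⟨ rank≤∣∣ᴬ meets ⟩
    ∣ φ F ∪ φ G ∣                  ∎
    where
    open ℕ.≤-Reasoning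
    meets : ∀ {x i} → x ∈ value F ∪ value G → x ∈ A i → i ∈ φ F ∪ φ G
    meets x∈ x∈A with x∈p∪q⁻ (value F) (value G) x∈
    ... | inj₁ x∈F = p⊆p∪q _ (meets⇒∈φ F x∈F x∈A)
    ... | inj₂ x∈G = q⊆p∪q (φ F) _ (meets⇒∈φ G x∈G x∈A)

  meet : MeetRank M φ U
  meet 𝓕 _ = ℕ.≤-antisym
    (rank≤∣∣ᴬ λ x∈ x∈A → ∈-⋂⁺ φ 𝓕 λ {F} F∈ → meets⇒∈φ F (∈-⋂⁻ value 𝓕 x∈ F∈) x∈A)
    (∣∣≤rank M b-injective b-indep λ i∈ → ∈-⋂⁺ value 𝓕 λ {F} F∈ → ∈φ⇒b∈ F (∈-⋂⁻ φ 𝓕 i∈ F∈))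

  φ-injective : ∀ {F G} → φ F ≡ φ G → F ≡ G
  φ-injective {F} {G} eq = value-injective (⊆-antisym (φ⊆⇒⊆ F G (⊆-reflexive eq))
                                                      (φ⊆⇒⊆ G F (⊆-reflexive (sym eq))))
    where
    open ℕ.≤-Reasoning
    -- Every `A i` meeting `G ∪ ⁅ x ⁆` has `i ∈ φ G`, so `x` does not raise the rank of the flat `G`
    -- and lies in it.
    φ⊆⇒⊆ : ∀ F G → φ F ⊆ φ G → value F ⊆ value G
    φ⊆⇒⊆ F G φF⊆φG {x} x∈F = subst (x ∈_) (flat M G) $ ∈-cl⁺ M (value G) $ ℕ.≤-antisym (begin
      rank M (value G ∪ ⁅ x ⁆)  ≤⟨ rank≤∣∣ᴬ meets ⟩
      ∣ φ G ∣                   ≡⟨ card G ⟩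
      rank M (value G)          ∎)
      (rank-mono M (p⊆p∪q _))
      where
      meets : ∀ {y i} → y ∈ value G ∪ ⁅ x ⁆ → y ∈ A i → i ∈ φ G
      meets y∈ y∈A with x∈p∪q⁻ (value G) _ y∈
      ... | inj₁ y∈G = meets⇒∈φ G y∈G y∈A
      ... | inj₂ y∈x with refl ← x∈⁅y⁆⇒x≡y x y∈x = φF⊆φG (meets⇒∈φ F x∈F y∈A)

-- Choosing distinct elements `b i` compatible with `φ`.

module Choice {n r} (M : Matroid n) (φ : 𝒵 M → Subset r)
              (card : CardIsRank M φ) (join-∪ : JoinToUnion M φ) (meet : MeetRank M φ U) where
  open Matroid M

  ∣φ-bottom∣≤0 : ∣ φ (bottom M) ∣ ≤ 0
  ∣φ-bottom∣≤0 = begin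
    ∣ φ (bottom M) ∣   ≡⟨ card (bottom M) ⟩
    rank M (cl M ⊥)    ≤⟨ rank-cl M ⊥ ⟩
    rank M ⊥           ≤⟨ rank≤∣∣ M ⊥ ⟩
    ∣ ⊥ {n = n} ∣      ≡⟨ ∣⊥∣≡0 n ⟩
    0                  ∎
    where open ℕ.≤-Reasoning

  ∉φ-bottom : ∀ {i} → i ∉ φ (bottom M)
  ∉φ-bottom {i} i∈ = ℕ.n≮0 (ℕ.<-≤-trans (x∈p⇒∣p-x∣<∣p∣ i∈) ∣φ-bottom∣≤0)

  -- `φ` turns joins into unions, and the empty join contributes nothing because it has rank 0.
  ∈φ-joins : ∀ {i} L → i ∈ φ (joins M L) → ∃ λ F → F ∈ˡ L × i ∈ φ F
  ∈φ-joins []          i∈ = contradiction i∈ ∉φ-bottom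
  ∈φ-joins {i} (F ∷ L) i∈ =
    [ (λ i∈F → F , here refl , i∈F)
    , (λ i∈L → let G , G∈L , i∈G = ∈φ-joins L i∈L in G , there G∈L , i∈G)
    ]′ (x∈p∪q⁻ (φ F) (φ (joins M L)) (subst (i ∈_) (join-∪ F (joins M L)) i∈))

  module _ (i : Fin r) where

    ∈φ? : Decidable (λ F → i ∈ φ F)
    ∈φ? F = i ∈? φ F

    ∉φ? : Decidable (λ F → i ∉ φ F)
    ∉φ? F = ¬? (∈φ? F)

    containing avoiding : Family M
    containing = filter ∈φ? (all𝒵 M)
    avoiding   = filter ∉φ? (all𝒵 M)

  -- For 𝓤 and 𝓛 the families of cyclic flats with i ∈ φ F and i ∉ φ F, these are the x
  -- with x ∈ F ⇔ i ∈ φ F and the j with j ∈ φ F ⇔ i ∈ φ F, for every cyclic flat F.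
  twins : Family M → Family M → Subset n
  twins 𝓤 𝓛 = ⋂ (map value 𝓤) ─ value (joins M 𝓛)

  twin-indices : Family M → Family M → Subset r
  twin-indices 𝓤 𝓛 = ⋂ (map φ 𝓤) ─ φ (joins M 𝓛)

  -- Condition (3) is applied to `𝓤` and to `H ∷ 𝓤`, giving the ranks of `D` and of `D ∩ H`. Their
  -- difference is at most the number of elements of `D` outside `H`.
  ∣twin-indices∣≤∣twins∣ : ∀ 𝓤 𝓛 → ∣ twin-indices 𝓤 𝓛 ∣ ≤ ∣ twins 𝓤 𝓛 ∣
  ∣twin-indices∣≤∣twins∣ 𝓤 𝓛 = ℕ.+-cancelˡ-≤ (∣ ⋂φ ∩ φ H ∣) (∣ ⋂φ ─ φ H ∣) (∣ D ─ value H ∣) $ begin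
    ∣ ⋂φ ∩ φ H ∣ + ∣ ⋂φ ─ φ H ∣            ≡⟨ ∣p∣≡∣p∩q∣+∣p─q∣ ⋂φ (φ H) ⟨
    ∣ ⋂φ ∣                                 ≡⟨ meet 𝓤 _ ⟨
    rank M D                               ≤⟨ rank-split M D (value H) ⟩
    rank M (D ∩ value H) + ∣ D ─ value H ∣ ≡⟨ cong (λ X → rank M X + ∣ D ─ value H ∣) (∩-comm D (value H)) ⟩
    rank M (value H ∩ D) + ∣ D ─ value H ∣ ≡⟨ cong (_+ ∣ D ─ value H ∣) (meet (H ∷ 𝓤) _) ⟩
    ∣ φ H ∩ ⋂φ ∣ + ∣ D ─ value H ∣         ≡⟨ cong (λ X → ∣ X ∣ + ∣ D ─ value H ∣) (∩-comm (φ H) ⋂φ) ⟩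
    ∣ ⋂φ ∩ φ H ∣ + ∣ D ─ value H ∣         ∎
    where
    open ℕ.≤-Reasoning
    H = joins M 𝓛
    D = ⋂ (map value 𝓤)
    ⋂φ = ⋂ (map φ 𝓤)

  ∈twin-indices : ∀ i → i ∈ twin-indices (containing i) (avoiding i)
  ∈twin-indices i = x∈p∧x∉q⇒x∈p─q
    (∈-⋂⁺ φ (containing i) λ F∈ → proj₂ (∈-filter⁻ (∈φ? i) {xs = all𝒵 M} F∈))
    λ i∈ → let F , F∈ , i∈F = ∈φ-joins (avoiding i) i∈ in
           proj₂ (∈-filter⁻ (∉φ? i) {xs = all𝒵 M} F∈) i∈F

  twinsOf : Fin r → Subset n
  twinsOf i = twins (containing i) (avoiding i)

  twin-indicesOf : Fin r → Subset r
  twin-indicesOf i = twin-indices (containing i) (avoiding i)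

  -- Indices with the same twins are sent to different elements, since they take
  -- different positions among their twin indices.
  choice : ∀ i → ∃ λ x → x ∈ twinsOf i × position (twinsOf i) x ≡ position (twin-indicesOf i) i
  choice i = nth (twinsOf i) (position (twin-indicesOf i) i)
    (ℕ.<-≤-trans (position<∣∣ {p = twin-indicesOf i} (∈twin-indices i))
                 (∣twin-indices∣≤∣twins∣ (containing i) (avoiding i)))

  b : Fin r → Fin n
  b i = proj₁ (choice i)

  b∈twins : ∀ i → b i ∈ twinsOf i
  b∈twins i = proj₁ (proj₂ (choice i))

  position-b : ∀ i → position (twinsOf i) (b i) ≡ position (twin-indicesOf i) i
  position-b i = proj₂ (proj₂ (choice i))

  -- `F` is one of the flats whose intersection contains `twinsOf i`.
  ∈φ⇒b∈ : ∀ F {i} → i ∈ φ F → b i ∈ value F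
  ∈φ⇒b∈ F {i} i∈ = ∈-⋂⁻ value (containing i)
    (p─q⊆p (⋂ (map value (containing i))) (value (joins M (avoiding i))) (b∈twins i))
    (∈-filter⁺ (∈φ? i) (∈-all𝒵 M F) i∈)

  -- Otherwise `F` lies below the join that `twinsOf i` avoids.
  b∈⇒∈φ : ∀ F {i} → b i ∈ value F → i ∈ φ F
  b∈⇒∈φ F {i} b∈ = decidable-stable (i ∈? φ F) λ i∉ →
    x∈p─q⇒x∉q (⋂ (map value (containing i))) (value (joins M (avoiding i))) (b∈twins i)
      (⊆joins M (avoiding i) (∈-filter⁺ (∉φ? i) (∈-all𝒵 M F) i∉) b∈)

  -- If `b i ≡ b j`, then `i` and `j` lie in the same sets `φ F`, hence have the same twins and twin
  -- indices. Their positions among the latter then agree.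
  b-injective : ∀ {i j} → b i ≡ b j → i ≡ j
  b-injective {i} {j} eq =
    position-injective (subst (i ∈_) same-indices (∈twin-indices i)) (∈twin-indices j) $ begin
      position (twin-indicesOf j) i    ≡⟨ cong (λ S → position S i) same-indices ⟨
      position (twin-indicesOf i) i    ≡⟨ position-b i ⟨
      position (twinsOf i) (b i)       ≡⟨ cong₂ position (cong₂ twins same-containing same-avoiding) eq ⟩
      position (twinsOf j) (b j)       ≡⟨ position-b j ⟩
      position (twin-indicesOf j) j    ∎
    where
    open ≡-Reasoning
    i⇒j : ∀ {F} → i ∈ φ F → j ∈ φ F
    i⇒j {F} = b∈⇒∈φ F ∘ subst (_∈ value F) eq ∘ ∈φ⇒b∈ F
    j⇒i : ∀ {F} → j ∈ φ F → i ∈ φ F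
    j⇒i {F} = b∈⇒∈φ F ∘ subst (_∈ value F) (sym eq) ∘ ∈φ⇒b∈ F
    same-containing : containing i ≡ containing j
    same-containing = filter-≐ (∈φ? i) (∈φ? j) (i⇒j , j⇒i) (all𝒵 M)
    same-avoiding : avoiding i ≡ avoiding j
    same-avoiding = filter-≐ (∉φ? i) (∉φ? j) ((_∘ j⇒i) , (_∘ i⇒j)) (all𝒵 M)
    same-indices : twin-indicesOf i ≡ twin-indicesOf j
    same-indices = cong₂ twin-indices same-containing same-avoiding

-- From the elements `b i` to a presentation with private elements.

module FundamentalBasis {n r} (M : Matroid n) (rank≤r : rank M ⊤ ≤ r)
  (φ : 𝒵 M → Subset r) (card : CardIsRank M φ)
  (b : Fin r → Fin n) (b-injective : ∀ {i j} → b i ≡ b j → i ≡ j)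
  (∈φ⇒b∈ : ∀ F {i} → i ∈ φ F → b i ∈ value F)
  (b∈⇒∈φ : ∀ F {i} → b i ∈ value F → i ∈ φ F) where
  open Matroid M

  spanned : ∀ {C} → Circuit M C → 𝒵 M
  spanned {C} circ = cl M C ,
    [ cl-cyclic M (cyclic⁺ M λ x∈C → C , circ , x∈C , ⊆-refl) , cl-flat M C ]

  -- By `card` the closure of `C` has only `rank M C` indices, fewer than `∣ C ∣`. Independence is
  -- proved below by injecting a supposed circuit into these indices.
  ¬∣C∣≤∣φ∣ : ∀ {C} (circ : Circuit M C) → ¬ (∣ C ∣ ≤ ∣ φ (spanned circ) ∣)
  ¬∣C∣≤∣φ∣ {C} circ le = proj₁ circ $ ∣∣≤rank⇒indep M $ begin
    ∣ C ∣                  ≤⟨ le ⟩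
    ∣ φ (spanned circ) ∣   ≡⟨ card (spanned circ) ⟩
    rank M (cl M C)        ≤⟨ rank-cl M C ⟩
    rank M C               ∎
    where open ℕ.≤-Reasoning

  no-circuit⇒indep : ∀ {I} → (∀ {C} → C ⊆ I → ¬ Circuit M C) → Indep I
  no-circuit⇒indep {I} none = decidable-stable (indep? I) λ dep →
    let C , C⊆I , circ = dependent⇒circuit M I dep in none C⊆I circ

  b-indep : Indep (image b ⊤)
  b-indep = no-circuit⇒indep λ {C} C⊆b circ → ¬∣C∣≤∣φ∣ circ $
    injection⇒∣∣≤∣∣ C _ (λ x x∈C → proj₁ (∈-image⁻ b (C⊆b x∈C)))
      (λ x x∈C → let i , _ , bi≡x = ∈-image⁻ b (C⊆b x∈C) in
        b∈⇒∈φ (spanned circ) (X⊆clX M C (subst (_∈ C) (sym bi≡x) x∈C)))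
      λ x∈C y∈C eq → trans (sym (proj₂ (proj₂ (∈-image⁻ b (C⊆b x∈C)))))
                           (trans (cong b eq) (proj₂ (proj₂ (∈-image⁻ b (C⊆b y∈C)))))

  ∣∣≤∣image-b∣ : ∀ S → ∣ S ∣ ≤ ∣ image b S ∣
  ∣∣≤∣image-b∣ = ∣∣≤∣image∣ b b-injective

  image-indep : ∀ {S} → Indep (image b S)
  image-indep = hereditary (image-mono b ⊆⊤) b-indep

  -- The `b i` with `i ∈ φ F` are independent elements of `F`, as many as its rank.
  spanned-by-b : ∀ F → value F ⊆ cl M (image b (φ F))
  spanned-by-b F = rank≤∣∣⇒spans M (image⊆ b (∈φ⇒b∈ F)) image-indep
    (subst (_≤ ∣ image b (φ F) ∣) (card F) (∣∣≤∣image-b∣ (φ F)))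

  ∈cl-image-⊤ : ∀ x → x ∈ cl M (image b ⊤)
  ∈cl-image-⊤ x = rank≤∣∣⇒spans M ⊆⊤ b-indep
    (ℕ.≤-trans rank≤r (subst (_≤ ∣ image b ⊤ ∣) (∣⊤∣≡n r) (∣∣≤∣image-b∣ ⊤))) ∈⊤

  omits? : ∀ i → Decidable (λ x → x ∉ cl M (image b (⊤ - i)))
  omits? i x = ¬? (x ∈? cl M (image b (⊤ - i)))

  -- x ∈ A i if and only if b i belongs to the fundamental circuit of x with respect
  -- to the basis b (or x = b i).
  A : Fin r → Subset n
  A i = ⟪ omits? i ⟫

  ∈A⁺ : ∀ i {x} → x ∉ cl M (image b (⊤ - i)) → x ∈ A i
  ∈A⁺ i = ∈⟪⟫⁺ (omits? i)

  ∈A⁻ : ∀ i {x} → x ∈ A i → x ∉ cl M (image b (⊤ - i))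
  ∈A⁻ i = ∈⟪⟫⁻ (omits? i)

  b∉cl : ∀ i → b i ∉ cl M (image b (⊤ - i))
  b∉cl i = indep⇒∉cl M
    (hereditary (∪-lub (image-mono b ⊆⊤) (⁅⁆⊆ (∈-image⁺ b {⊤} ∈⊤))) b-indep)
    λ b∈ → let j , j∈ , bj≡bi = ∈-image⁻ b b∈ in y∈p-x⇒y≢x ⊤ j∈ (b-injective bj≡bi)

  -- For `j ≢ i`, `b i` is among the elements spanning the complement of `A j`.
  private-element : ∀ i → Nonempty (A i ─ others A i)
  private-element i = b i , x∈p∧x∉q⇒x∈p─q (∈A⁺ i (b∉cl i)) λ b∈others →
    let X , X∈ , b∈X = ∈-⋃⁻ (map A (filter (λ j → ¬? (j ≟ i)) (allFin r))) b∈others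
        j , j∈ , X≡Aj = ∈-map⁻ A X∈
        j≢i = proj₂ (∈-filter⁻ (λ j → ¬? (j ≟ i)) {xs = allFin r} j∈)
    in ∈A⁻ j (subst (b i ∈_) X≡Aj b∈X)
         (X⊆clX M _ (∈-image⁺ b (x∈p∧x≢y⇒x∈p-y ∈⊤ (j≢i ∘ sym))))

  -- Otherwise exchange puts `b i` in the closure of `x` and the `b j` with `j ∈ S - i`, hence in
  -- that of all `b j` with `j ≢ i`, against `b∉cl`.
  cl-image-remove : ∀ {x} S i → x ∈ cl M (image b S) → x ∈ cl M (image b (⊤ - i)) →
                    x ∈ cl M (image b (S - i))
  cl-image-remove {x} S i x∈S x∈⊤-i = decidable-stable (x ∈? _) λ x∉ →
    b∉cl i $ cl⊆cl M (∪-lub (X⊆clX M _ ∘ image-mono b S-i⊆⊤-i) (⁅⁆⊆ x∈⊤-i)) $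
    cl-exchange M (cl-mono M (image⊆ b split) x∈S) x∉
    where
    S-i⊆⊤-i : S - i ⊆ ⊤ - i
    S-i⊆⊤-i j∈ = x∈p∧x≢y⇒x∈p-y ∈⊤ (y∈p-x⇒y≢x S j∈)
    split : ∀ {j} → j ∈ S → b j ∈ image b (S - i) ∪ ⁅ b i ⁆
    split {j} j∈S with j ≟ i
    ... | yes refl = x∈p∪⁅x⁆ (image b (S - i))
    ... | no j≢i = p⊆p∪q _ (∈-image⁺ b (x∈p∧x≢y⇒x∈p-y j∈S j≢i))

  -- The whole basis spans `x`; each `i` with `x ∉ A i` is discarded in turn by `cl-image-remove`.
  ∈cl-support : ∀ x → x ∈ cl M (image b ⟪ (λ i → x ∈? A i) ⟫)
  ∈cl-support x = cl-mono M (image-mono b remaining⊆) (remove (allFin r))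
    where
    drop : Fin r → Subset r → Subset r
    drop i S with x ∈? A i
    ... | yes _ = S
    ... | no  _ = S - i
    remove : ∀ L → x ∈ cl M (image b (foldr drop ⊤ L))
    remove [] = ∈cl-image-⊤ x
    remove (i ∷ L) with x ∈? A i
    ... | yes _ = remove L
    ... | no x∉ = cl-image-remove _ i (remove L) (decidable-stable (x ∈? _) (x∉ ∘ ∈A⁺ i))
    kept : ∀ {i} L → i ∈ˡ L → i ∈ foldr drop ⊤ L → x ∈ A i
    kept (j ∷ L) i∈L i∈ with x ∈? A j
    kept (j ∷ L) (here refl) i∈ | yes x∈ = x∈
    kept (j ∷ L) (there i∈L) i∈ | yes x∈ = kept L i∈L i∈
    kept (j ∷ L) (here refl) i∈ | no x∉ = contradiction refl (y∈p-x⇒y≢x _ i∈)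
    kept (j ∷ L) (there i∈L) i∈ | no x∉ = kept L i∈L (p─q⊆p _ _ i∈)
    remaining⊆ : foldr drop ⊤ (allFin r) ⊆ ⟪ (λ i → x ∈? A i) ⟫
    remaining⊆ {i} i∈ = ∈⟪⟫⁺ (λ i → x ∈? A i) (kept (allFin r) (∈-allFin i) i∈)

  -- If `cl M Y` contained every `b i` with `x ∈ A i`, it would contain `x` by `∈cl-support`.
  exchange-index : ∀ {x Y} → x ∉ cl M Y → ∃ λ i → x ∈ A i × b i ∉ cl M Y
  exchange-index {x} {Y} x∉ =
    decidable-stable (any? λ i → (x ∈? A i) ×-dec ¬? (b i ∈? cl M Y)) λ none →
      x∉ (cl⊆cl M (image⊆ b λ {i} i∈ → decidable-stable (b i ∈? cl M Y) λ b∉ →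
        none (i , ∈⟪⟫⁻ (λ i → x ∈? A i) i∈ , b∉)) (∈cl-support x))

  Unused : Subset r → Fin n → Fin r → Set
  Unused K x i = x ∈ A i × i ∉ K

  -- Instead of appealing to Hall's theorem, x ∈ I is matched to an index i with x ∈ A i
  -- for which I stays independent when b i replaces x; K collects the indices in use.
  match : ∀ I K → Acc _<_ ∣ I ∣ → Indep (I ∪ image b K) → (∀ {x} → x ∈ I → x ∉ image b K) →
          Matching (Unused K) I
  match I K (acc rs) ind disj with nonempty? I
  ... | no empty = (λ x x∈I → contradiction (x , x∈I) empty)
                 , (λ x x∈I → contradiction (x , x∈I) empty)
                 , λ x∈I _ _ → contradiction (_ , x∈I) empty
  ... | yes (x , x∈I) = step (exchange-index x∉clY)
    where
    Y = (I - x) ∪ image b K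
    Y⊆ : Y ⊆ I ∪ image b K
    Y⊆ = ∪-lub (p⊆p∪q _ ∘ p─q⊆p I _) (q⊆p∪q I _)
    Y-indep : Indep Y
    Y-indep = hereditary Y⊆ ind
    x∉Y : x ∉ Y
    x∉Y x∈Y with x∈p∪q⁻ (I - x) (image b K) x∈Y
    ... | inj₁ x∈I-x = y∈p-x⇒y≢x I x∈I-x refl
    ... | inj₂ x∈K = disj x∈I x∈K
    x∉clY : x ∉ cl M Y
    x∉clY = indep⇒∉cl M (hereditary (∪-lub Y⊆ (⁅⁆⊆ (p⊆p∪q _ x∈I))) ind) x∉Y
    K→clY : ∀ {j} → j ∈ K → b j ∈ cl M Y
    K→clY j∈K = X⊆clX M Y (q⊆p∪q (I - x) _ (∈-image⁺ b j∈K))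
    split : ∀ i {j} → j ∈ K ∪ ⁅ i ⁆ → b j ∈ Y ∪ ⁅ b i ⁆
    split i j∈ with x∈p∪q⁻ K ⁅ i ⁆ j∈
    ... | inj₁ j∈K = p⊆p∪q _ (q⊆p∪q (I - x) _ (∈-image⁺ b j∈K))
    ... | inj₂ j∈i with refl ← x∈⁅y⁆⇒x≡y i j∈i = x∈p∪⁅x⁆ Y
    disj′ : ∀ i → b i ∉ cl M Y → ∀ {y} → y ∈ I - x → y ∉ image b (K ∪ ⁅ i ⁆)
    disj′ i b∉ y∈ y∈image with j , j∈ , refl ← ∈-image⁻ b y∈image with x∈p∪q⁻ K ⁅ i ⁆ j∈
    ... | inj₁ j∈K = disj (p─q⊆p I _ y∈) (∈-image⁺ b j∈K)
    ... | inj₂ j∈i with refl ← x∈⁅y⁆⇒x≡y i j∈i = b∉ (X⊆clX M Y (p⊆p∪q _ y∈))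
    step : (∃ λ i → x ∈ A i × b i ∉ cl M Y) → Matching (Unused K) I
    step (i , x∈Ai , b∉) = extend-matching {R = Unused K} (x∈Ai , b∉ ∘ K→clY) $
      map-matching {R = Unused (K ∪ ⁅ i ⁆)} {Q = λ y j → Unused K y j × j ≢ i}
        (λ (y∈A , ∉K∪i) → (y∈A , ∉K∪i ∘ p⊆p∪q _) , λ { refl → ∉K∪i (x∈p∪⁅x⁆ K) }) $
      match (I - x) (K ∪ ⁅ i ⁆) (rs (x∈p⇒∣p-x∣<∣p∣ x∈I))
        (hereditary (∪-lub (p⊆p∪q _ ∘ p⊆p∪q _) (image⊆ b (split i))) (indep∪⁅⁆ M Y-indep b∉))
        (disj′ i b∉)

  ∉image-⊥ : ∀ {x} → x ∉ image b ⊥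
  ∉image-⊥ x∈ = ∉⊥ (proj₁ (proj₂ (∈-image⁻ b {⊥} x∈)))

  indep⇒matching : ∀ {I} → Indep I → Matching (λ x i → x ∈ A i) I
  -- No index is in use at the start, so `K` is `⊥`.
  indep⇒matching {I} ind = map-matching {R = Unused ⊥} proj₁ $ match I ⊥ (<-wellFounded _)
    (hereditary (∪-lub ⊆-refl (λ x∈ → contradiction x∈ ∉image-⊥)) ind) (λ _ → ∉image-⊥)

  -- If `i ∉ φ F`, then `F` is spanned by elements `b j` with `j ≢ i`, so it misses `A i`.
  meets⇒∈φ : ∀ F {x i} → x ∈ value F → x ∈ A i → i ∈ φ F
  meets⇒∈φ F {x} {i} x∈F x∈Ai = decidable-stable (i ∈? φ F) λ i∉ →
    ∈A⁻ i x∈Ai $ cl-mono M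
      (image-mono b λ j∈ → x∈p∧x≢y⇒x∈p-y ∈⊤ λ { refl → i∉ j∈ })
      (spanned-by-b F x∈F)

  -- By `meets⇒∈φ`, a matching would inject a circuit `C` into the indices of its closure.
  matching⇒indep : ∀ {I} → Matching (λ x i → x ∈ A i) I → Indep I
  matching⇒indep (f , f∈A , f-inj) = no-circuit⇒indep λ {C} C⊆I circ → ¬∣C∣≤∣φ∣ circ $
    injection⇒∣∣≤∣∣ C _ (λ x x∈C → f x (C⊆I x∈C))
      (λ x x∈C → meets⇒∈φ (spanned circ) (X⊆clX M C x∈C) (f∈A x (C⊆I x∈C)))
      λ _ _ → f-inj _ _

  fundamental : FundamentalTransversal M
  fundamental = r , A ,
    (λ I → mk⇔ (matching⇒transversal A ∘ indep⇒matching)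
               (matching⇒indep ∘ transversal⇒matching A)) ,
    private-element

-- Assembly of the equivalences.

necessity : ∀ {n} (M : Matroid n) → FundamentalTransversal M →
  ∃ λ (φ : 𝒵 M ↣ Subset (rank M ⊤)) →
    CardIsRank M (to φ) × JoinToUnion M (to φ) × MeetRank M (to φ) U
necessity M (s , A , presents , private-element) =
  -- `φ` takes values in subsets of the `s` indices of the presentation; `s≡rank` moves it to the
  -- required target.
  subst (λ r → ∃ λ (φ : 𝒵 M ↣ Subset r) →
          CardIsRank M (to φ) × JoinToUnion M (to φ) × MeetRank M (to φ) U)
        s≡rank (mk↣ φ-injective , card , join-∪ , meet)
  where open Necessity M A presents private-element

sufficiency : ∀ {n} (M : Matroid n) (φ : 𝒵 M → Subset (rank M ⊤)) →
  CardIsRank M φ → JoinToUnion M φ → MeetRank M φ U → FundamentalTransversal M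
sufficiency M φ card join-∪ meet =
  FundamentalBasis.fundamental M ℕ.≤-refl φ card b b-injective ∈φ⇒b∈ b∈⇒∈φ
  where open Choice M φ card join-∪ meet

theorem4p5 : ∀ {n : ℕ} (M : Matroid n) →
    (FundamentalTransversal M ⇔
    (∃ λ (φ : 𝒵 M ↣ Subset (rank M ⊤)) →
    CardIsRank M (to φ) × JoinToUnion M (to φ) × MeetRank M (to φ) U))
    ×
    (∀ (φ : 𝒵 M ↣ Subset (rank M ⊤)) →
    CardIsRank M (to φ) → JoinToUnion M (to φ) →
    (MeetRank M (to φ) U ⇔ MeetRank M (to φ) (Filter M)) ×
    (MeetRank M (to φ) U ⇔ MeetRank M (to φ) (Antichain M)))
theorem4p5 M =
  mk⇔ (necessity M) (λ (φ , card , join-∪ , meet) → sufficiency M (to φ) card join-∪ meet) ,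
  λ φ card join-∪ →
    mk⇔ (λ meet 𝓕 _ → meet 𝓕 _)
        (coinitial⇒MeetRank-U M (to φ) join-∪ {𝒞 = Filter M} λ 𝓕 → up-closure M 𝓕 ,
          (λ {A} {B} → up-closure-filter M 𝓕 {A} {B}) ,
          (λ {F} F∈ → F , ∈-up-closure⁺ M F∈ ⊆-refl , ⊆-refl) ,
          ∈-up-closure⁻ M 𝓕) ,
    mk⇔ (λ meet 𝓕 _ → meet 𝓕 _)
        (coinitial⇒MeetRank-U M (to φ) join-∪ {𝒞 = Antichain M} λ 𝓕 → minimals M 𝓕 ,
          (λ {A} {B} → minimals-antichain M 𝓕 {A} {B}) ,
          minimal-below M 𝓕 ,
          λ {F} F∈ → F , minimals⊆ M 𝓕 F∈ , ⊆-refl)
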